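{- Let $G=G(V,E)$ be a comparability graph with $V=\{v_1,\dots,v_n\}$. For $u_1,\dots,u_k\in V$ let $G\backslash u_1\cdots u_k$ denote the induced subgraph of $G$ on $V\backslash\{u_1,\dots,u_k\}$. Then $$\varepsilon(G)\geq\sum_{\sigma\in\mathfrak{S}_n}\frac{1}{\chi(G)\,\chi(G\backslash v_{\sigma1})\,\chi(G\backslash v_{\sigma1}v_{\sigma2})\cdots\chi(G\backslash v_{\sigma1}\cdots v_{\sigma(n-1)})},$$ where $\mathfrak{S}_n$ is the symmetric group on $[n]$ and $\chi$ denotes chromatic number (the last factor being the chromatic number of the single-vertex graph on $v_{\sigma n}$).
   Context: A comparability graph is a simple graph $G=G(V,E)$ such that there is a partial order on $V$ under which distinct $u,v$ are comparable iff $\{u,v\}\in E$. For a simple graph $G$, $\varepsilon(G)$ denotes the maximum, over all acyclic orientations of $E$, of the number of linear extensions of the partial order on $V$ induced by the orientation ($u<v$ iff there is a directed path from $u$ to $v$; a linear extension is a bijection $f:V\to[|V|]$ with $f(u)<f(v)$ whenever $u<v$). -}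

module Defs where

open import Data.Bool using (Bool; true; false)
open import Data.Nat as ℕ using (ℕ; zero; suc)
open import Data.Integer using (+_)
open import Data.Fin as Fin using (Fin)
open import Data.Fin.Subset using (Subset; ⊤; _∈_; _-_)
open import Data.Vec using (Vec; lookup)
open import Data.List using (List; []; _∷_; length; map; concatMap; foldr; allFin)
open import Data.List.Membership.Propositional as LM using ()
open import Data.List.Relation.Unary.Unique.Propositional using (Unique)
open import Data.Rational as ℚ using (ℚ; 0ℚ; _/_)
open import Data.Product using (Σ; ∃; _×_; _,_)
open import Data.Sum using (_⊎_)
open import Relation.Nullary using (¬_)
open import Relation.Binary.PropositionalEquality using (_≡_; _≢_)
open import Relation.Binary.Structures using (IsPartialOrder)
open import Relation.Binary.Construct.Closure.Transitive using (TransClosure)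
open import Function.Definitions using (Bijective)
open import Function.Bundles using (_⇔_)

record SimpleGraph (n : ℕ) : Set where
  field
    adj   : Fin n → Fin n → Bool
    sym   : ∀ u v → adj u v ≡ adj v u
    irrfl : ∀ u → adj u u ≡ false
open SimpleGraph public

IsComparabilityGraph : ∀ {n} → SimpleGraph n → Set₁
IsComparabilityGraph {n} G =
  Σ (Fin n → Fin n → Set) λ _≼_ →
    IsPartialOrder _≡_ _≼_ ×
    (∀ u v → u ≢ v → (adj G u v ≡ true ⇔ (u ≼ v ⊎ v ≼ u)))

-- Orientations of E: O u v ≡ true means the edge {u,v} is directed u → v.
IsOrientation : ∀ {n} → SimpleGraph n → (Fin n → Fin n → Bool) → Set
IsOrientation {n} G O =
  (∀ u v → adj G u v ≡ true →
     (O u v ≡ true × O v u ≡ false) ⊎ (O u v ≡ false × O v u ≡ true)) ×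
  (∀ u v → O u v ≡ true → adj G u v ≡ true)

-- Strict order induced by an orientation: u < v iff there is a directed path u → v.
Path : ∀ {n} → (Fin n → Fin n → Bool) → Fin n → Fin n → Set
Path O = TransClosure (λ a b → O a b ≡ true)

IsAcyclicOrientation : ∀ {n} → SimpleGraph n → (Fin n → Fin n → Bool) → Set
IsAcyclicOrientation G O = IsOrientation G O × (∀ u → ¬ Path O u u)

-- A linear extension, a bijection f : V → [|V|] (here [|V|] = Fin n),
-- represented by its table of values (f u = lookup w u).
IsLinearExtension : ∀ {n} → (Fin n → Fin n → Bool) → Vec (Fin n) n → Set
IsLinearExtension O w =
  Bijective _≡_ _≡_ (lookup w) ×
  (∀ a b → Path O a b → lookup w a Fin.< lookup w b)

NumLinearExtensions : ∀ {n} → (Fin n → Fin n → Bool) → ℕ → Set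
NumLinearExtensions {n} O k =
  Σ (List (Vec (Fin n) n)) λ L →
    length L ≡ k × Unique L × (∀ w → (w LM.∈ L) ⇔ IsLinearExtension O w)

IsEpsilon : ∀ {n} → SimpleGraph n → ℕ → Set
IsEpsilon G e =
  (∃ λ O → ∃ λ k → IsAcyclicOrientation G O × NumLinearExtensions O k × k ≡ e) ×
  (∀ O k → IsAcyclicOrientation G O → NumLinearExtensions O k → k ℕ.≤ e)

IsProperColouring : ∀ {n} → SimpleGraph n → (S : Subset n) (k : ℕ) →
                    ((u : Fin n) → u ∈ S → Fin k) → Set
IsProperColouring G S k c =
  ∀ u v (pu : u ∈ S) (pv : v ∈ S) → adj G u v ≡ true → c u pu ≢ c v pv

Colourable : ∀ {n} → SimpleGraph n → Subset n → ℕ → Set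
Colourable G S k = Σ ((u : _) → u ∈ S → Fin k) (IsProperColouring G S k)

IsChromaticNumber : ∀ {n} → SimpleGraph n → Subset n → ℕ → Set
IsChromaticNumber G S c = Colourable G S c × (∀ k → Colourable G S k → c ℕ.≤ k)

-- All permutations of a list (insertion-based); permutations (allFin n)
-- lists each σ ∈ 𝔖_n exactly once as [σ1, …, σn].
insertions : ∀ {A : Set} → A → List A → List (List A)
insertions x []       = (x ∷ []) ∷ []
insertions x (y ∷ ys) = (x ∷ y ∷ ys) ∷ map (y ∷_) (insertions x ys)

permutations : ∀ {A : Set} → List A → List (List A)
permutations []       = [] ∷ []
permutations (x ∷ xs) = concatMap (insertions x) (permutations xs)

chiProduct : ∀ {n} → (Subset n → ℕ) → Subset n → List (Fin n) → ℕ
chiProduct chi S []       = 1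
chiProduct chi S (x ∷ xs) = chi S ℕ.* chiProduct chi (S - x) xs

-- 1/m as a rational; the value at 0 is an irrelevant convention (never used:
-- every factor is the chromatic number of a nonempty graph, hence ≥ 1).
recip : ℕ → ℚ
recip zero    = 0ℚ
recip (suc m) = + 1 / suc m

chiSum : ∀ n → (Subset n → ℕ) → ℚ
chiSum n chi = foldr ℚ._+_ 0ℚ (map (λ σ → recip (chiProduct chi ⊤ σ)) (permutations (allFin n)))

{-# OPTIONS --safe #-}
module Submission where

-- Orient G along its partial order ≺ and let e(S) be the number of linear
-- extensions of the induced order on S ⊆ V, written as words listing S. An
-- antichain A ⊆ S satisfies Σ_{v ∈ A} e(S - v) ≤ e(S): promotion turns a
-- linear extension of S - v into one of S, and (v, w) can be recovered from
-- the result as long as v is known to lie in A. The χ(S) colour classes of an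
-- optimal colouring of S are antichains, so Σ_{v ∈ S} e(S - v) ≤ χ(S) e(S).
-- The sum f(S) in the theorem satisfies f(S) = χ(S)⁻¹ Σ_{v ∈ S} f(S - v), whence
-- f(S) ≤ e(S) by induction on |S|.

open import Defs hiding (sym)
open import Algebra.Bundles using (CommutativeMonoid)
open import Data.Bool using (Bool; true; false; if_then_else_)
import Data.Bool.Properties as Bool
open import Data.Nat as ℕ using (ℕ; zero; suc)
import Data.Nat.Properties as ℕ
open import Data.Integer as ℤ using (+_)
import Data.Integer.Properties as ℤ
open import Data.Rational as ℚ using (ℚ; 0ℚ; 1ℚ; _≤_; _/_; fromℚᵘ)
import Data.Rational.Properties as ℚ
open import Data.Rational.Unnormalised as ℚᵘ using (mkℚᵘ; *≤*)
import Data.Rational.Unnormalised.Properties as ℚᵘ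
open import Data.Fin as Fin using (Fin)
import Data.Fin.Properties as Fin
open import Data.Fin.Subset as Subset using (Subset)
import Data.Fin.Subset.Properties as Subset
open import Data.Vec as Vec using (Vec; []; _∷_)
import Data.Vec.Properties as Vec
open import Data.List
  using (List; []; _∷_; _++_; length; map; concatMap; foldr; filter; lookup; drop; upTo; allFin;
         cartesianProduct; cartesianProductWith)
open import Data.List.Properties
  using (length-++; length-map; length-upTo; length-tabulate; map-∘; map-cong; ∷-injective; ∷-injectiveʳ)
open import Data.List.Membership.Propositional using (_∈_; _∉_; lose; find)
open import Data.List.Membership.Propositional.Properties
  using (∈-lookup; ∈-map⁻; ∈-map⁺; ∈-concatMap⁺; ∈-concatMap⁻; ∈-filter⁺; ∈-filter⁻; ∈-∃++; ∈-upTo⁺;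
         ∈-allFin; ∈-cartesianProduct⁺; ∈-cartesianProductWith⁺)
open import Data.List.Membership.Setoid.Properties using (index-injective)
open import Data.List.Relation.Unary.All as All using ([]; _∷_)
import Data.List.Relation.Unary.All.Properties as All
open import Data.List.Relation.Unary.AllPairs using (AllPairs; []; _∷_; allPairs?)
import Data.List.Relation.Unary.AllPairs.Properties as AllPairs
open import Data.List.Relation.Unary.Any using (here; there; index)
open import Data.List.Relation.Unary.Any.Properties using (lookup-index)
open import Data.List.Relation.Unary.Unique.Propositional using (Unique)
import Data.List.Relation.Unary.Unique.Propositional.Properties as Unique
open import Data.List.Relation.Binary.Pointwise using (Pointwise-≡⇒≡; lookup⁻)
open import Data.List.Relation.Binary.Permutation.Propositional
  using (_↭_; prep; swap; ↭-refl; ↭-sym; ↭-trans; ↭⇒↭ₛ)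
open import Data.List.Relation.Binary.Permutation.Propositional.Properties
  using (∈-resp-↭; ¬x∷xs↭[]; ↭-length; ↭-empty-inv; drop-mid)
import Data.List.Relation.Binary.Permutation.Setoid.Properties as ↭ₛ
open import Data.Product using (_×_; _,_; proj₁; proj₂; ∃; map₂)
open import Data.Sum using (inj₁; inj₂)
open import Function using (_∘_; case_of_)
open import Function.Bundles using (mk⇔; Equivalence)
open import Level using (0ℓ)
open import Relation.Nullary using (¬_; Dec; yes; no; does; contradiction; ¬?)
open import Relation.Nullary.Decidable using (_×-dec_; _→-dec_; dec-true; dec-false)
open import Relation.Unary using (Pred; Decidable)
open import Relation.Binary using (Rel; tri<; tri≈; tri>)
open import Relation.Binary.Structures using (IsPartialOrder)
open import Relation.Binary.Construct.Closure.Transitive using ([_]; _∷_)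
open import Relation.Binary.PropositionalEquality
  using (_≡_; _≢_; refl; sym; trans; cong; cong₂; subst; setoid; module ≡-Reasoning)

-- Lists without repetition: counting by injections, and permutations generated by insertion.

module _ {A : Set} where

  lookup-AllPairs : ∀ {R : Rel A 0ℓ} {xs} → AllPairs R xs →
                    ∀ {i j} → i Fin.< j → R (lookup xs i) (lookup xs j)
  lookup-AllPairs (r ∷ _)  {Fin.zero}  {Fin.suc j} _   = All.lookup r (∈-lookup j)
  lookup-AllPairs (_ ∷ rs) {Fin.suc i} {Fin.suc j} i<j = lookup-AllPairs rs (ℕ.s≤s⁻¹ i<j)

  lookup-Unique-injective : ∀ {xs : List A} → Unique xs → ∀ {i j} → lookup xs i ≡ lookup xs j → i ≡ j
  lookup-Unique-injective u {i} {j} eq with Fin.<-cmp i j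
  ... | tri< i<j _ _ = contradiction eq (lookup-AllPairs u i<j)
  ... | tri≈ _ i≡j _ = i≡j
  ... | tri> _ _ j<i = contradiction (sym eq) (lookup-AllPairs u j<i)

  -- Indices of the images give an injection from `Fin (length xs)` to `Fin (length ys)`. The map
  -- `f` may use the membership proof, since `positions` below is defined only on permutations of
  -- `allFin n`.
  length-≤-injection : ∀ {B : Set} {xs : List A} {ys : List B} → Unique xs →
    (f : ∀ {x} → x ∈ xs → B) → (∀ {x} (p : x ∈ xs) → f p ∈ ys) →
    (∀ {x y} (p : x ∈ xs) (q : y ∈ xs) → f p ≡ f q → x ≡ y) → length xs ℕ.≤ length ys
  length-≤-injection {B} u f f∈ inj = Fin.injective⇒≤ {f = λ i → index (f∈ (∈-lookup i))}
    λ {i} {j} eq → lookup-Unique-injective u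
      (inj (∈-lookup i) (∈-lookup j) (index-injective (setoid B) (f∈ (∈-lookup i)) (f∈ (∈-lookup j)) eq))

  length-cartesianProduct : ∀ {B : Set} (xs : List A) (ys : List B) →
    length (cartesianProduct xs ys) ≡ length xs ℕ.* length ys
  length-cartesianProduct []       ys = refl
  length-cartesianProduct (x ∷ xs) ys = trans (length-++ (map (x ,_) ys))
    (cong₂ ℕ._+_ (length-map (x ,_) ys) (length-cartesianProduct xs ys))

  ∈-insertions⁻ : ∀ x (σ : List A) {τ} → τ ∈ insertions x σ → τ ↭ x ∷ σ
  ∈-insertions⁻ x []      (here refl) = ↭-refl
  ∈-insertions⁻ x (y ∷ σ) (here refl) = ↭-refl
  ∈-insertions⁻ x (y ∷ σ) (there τ∈) with ∈-map⁻ (y ∷_) τ∈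
  ... | _ , ρ∈ , refl = ↭-trans (prep y (∈-insertions⁻ x σ ρ∈)) (swap y x ↭-refl)

  ∈-insertions⁺ : ∀ x (σ₁ σ₂ : List A) → σ₁ ++ x ∷ σ₂ ∈ insertions x (σ₁ ++ σ₂)
  ∈-insertions⁺ x []       []      = here refl
  ∈-insertions⁺ x []       (_ ∷ _) = here refl
  ∈-insertions⁺ x (y ∷ σ₁) σ₂      = there (∈-map⁺ (y ∷_) (∈-insertions⁺ x σ₁ σ₂))

  ∈-permutations⁻ : ∀ (xs : List A) {σ} → σ ∈ permutations xs → σ ↭ xs
  ∈-permutations⁻ []       (here refl) = ↭-refl
  ∈-permutations⁻ (x ∷ xs) σ∈ with find (∈-concatMap⁻ (insertions x) σ∈)
  ... | τ , τ∈ , σ∈′ = ↭-trans (∈-insertions⁻ x τ σ∈′) (prep x (∈-permutations⁻ xs τ∈))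

  ∈-permutations⁺ : ∀ (xs : List A) {σ} → σ ↭ xs → σ ∈ permutations xs
  ∈-permutations⁺ []       p rewrite ↭-empty-inv p = here refl
  ∈-permutations⁺ (x ∷ xs) p with ∈-∃++ (∈-resp-↭ (↭-sym p) (here refl))
  ... | σ₁ , σ₂ , refl = ∈-concatMap⁺ (insertions x)
    (lose (∈-permutations⁺ xs (drop-mid σ₁ [] p)) (∈-insertions⁺ x σ₁ σ₂))

  insertions-unique : ∀ {x} {σ : List A} → x ∉ σ → Unique (insertions x σ)
  insertions-unique {x} {[]}    _  = [] ∷ []
  insertions-unique {x} {y ∷ σ} x∉ =
    All.tabulate (λ τ∈ eq → x∉ (here (head-eq τ∈ eq)))
    ∷ Unique.map⁺ ∷-injectiveʳ (insertions-unique (x∉ ∘ there))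
    where
    head-eq : ∀ {τ} → τ ∈ map (y ∷_) (insertions x σ) → x ∷ y ∷ σ ≡ τ → x ≡ y
    head-eq τ∈ eq with ∈-map⁻ (y ∷_) τ∈
    ... | _ , _ , refl = proj₁ (∷-injective eq)

  -- Deleting the only occurrence of `x` from `τ` recovers the word it was inserted into. Hence
  -- distinct words have disjoint sets of insertions.
  insertions-determine : ∀ {x} {σ σ′ τ : List A} → x ∉ σ → x ∉ σ′ →
                         τ ∈ insertions x σ → τ ∈ insertions x σ′ → σ ≡ σ′
  insertions-determine {σ = []}    {[]}     _ _ _ _ = refl
  insertions-determine {σ = []}    {_ ∷ _}  _ x∉′ (here refl) (here ())
  insertions-determine {x} {σ = []} {z ∷ σ′} _ x∉′ (here refl) (there q) with ∈-map⁻ (z ∷_) q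
  ... | _ , _ , refl = contradiction (here refl) x∉′
  insertions-determine {σ = _ ∷ _} {[]}     x∉ _ (here ()) (here refl)
  insertions-determine {σ = y ∷ σ} {[]}     x∉ _ (there p) (here refl) with ∈-map⁻ (y ∷_) p
  ... | _ , _ , refl = contradiction (here refl) x∉
  insertions-determine {σ = y ∷ σ} {z ∷ σ′} x∉ x∉′ (here refl) (here refl) = refl
  insertions-determine {σ = y ∷ σ} {z ∷ σ′} x∉ x∉′ (here refl) (there q) with ∈-map⁻ (z ∷_) q
  ... | _ , _ , refl = contradiction (here refl) x∉′
  insertions-determine {σ = y ∷ σ} {z ∷ σ′} x∉ x∉′ (there p) (here refl) with ∈-map⁻ (y ∷_) p
  ... | _ , _ , refl = contradiction (here refl) x∉
  insertions-determine {σ = y ∷ σ} {z ∷ σ′} x∉ x∉′ (there p) (there q)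
    with ∈-map⁻ (y ∷_) p | ∈-map⁻ (z ∷_) q
  ... | _ , p′ , refl | _ , q′ , refl =
    cong (y ∷_) (insertions-determine (x∉ ∘ there) (x∉′ ∘ there) p′ q′)

  permutations-unique : ∀ {xs : List A} → Unique xs → Unique (permutations xs)
  permutations-unique {[]}     _ = [] ∷ []
  permutations-unique {x ∷ xs} (x≢ ∷ u) = Unique.concat⁺
    (All.map⁺ (All.tabulate (insertions-unique ∘ x∉)))
    (AllPairs.map⁺ (disjoint (permutations-unique u) x∉))
    where
    x∉ : ∀ {σ} → σ ∈ permutations xs → x ∉ σ
    x∉ σ∈ x∈ = All.lookup x≢ (∈-resp-↭ (∈-permutations⁻ xs σ∈) x∈) refl
    disjoint : ∀ {σs} → Unique σs → (∀ {σ} → σ ∈ σs → x ∉ σ) →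
               AllPairs (λ σ σ′ → ∀ {τ} → ¬ (τ ∈ insertions x σ × τ ∈ insertions x σ′)) σs
    disjoint []        _ = []
    disjoint (σ≢ ∷ us) f =
      All.tabulate (λ σ′∈ (p , q) → All.lookup σ≢ σ′∈
        (insertions-determine (f (here refl)) (f (there σ′∈)) p q))
      ∷ disjoint us (f ∘ there)

-- Promotion of words and its inverse on antichains.

module Promotion {A : Set} (_≺_ : Rel A 0ℓ) (_≺?_ : ∀ x y → Dec (x ≺ y))
  (≺-irrefl : ∀ {x} → ¬ x ≺ x) (≺-trans : ∀ {x y z} → x ≺ y → y ≺ z → x ≺ z) where

  Linear : List A → Set
  Linear = AllPairs (λ x y → ¬ y ≺ x)

  linear? : Decidable Linear
  linear? = allPairs? λ x y → ¬? (y ≺? x)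

  -- Promotion reads a word from the right; the head c of the list is the carried letter.
  step : A → List A → List A
  step y []       = y ∷ []
  step y (c ∷ zs) with y ≺? c
  ... | yes _ = y ∷ c ∷ zs
  ... | no  _ = c ∷ y ∷ zs

  -- `a` enters at the right end and moves left until it meets a letter below it; there it stops,
  -- and that letter moves on by the same rule.
  promote : A → List A → List A
  promote a = foldr step (a ∷ [])

  step-↭ : ∀ y zs → step y zs ↭ y ∷ zs
  step-↭ y []       = ↭-refl
  step-↭ y (c ∷ zs) with y ≺? c
  ... | yes _ = ↭-refl
  ... | no  _ = swap c y ↭-refl

  promote-↭ : ∀ a ys → promote a ys ↭ a ∷ ys
  promote-↭ a []       = ↭-refl
  promote-↭ a (y ∷ ys) = ↭-trans (step-↭ y _) (↭-trans (prep y (promote-↭ a ys)) (swap y a ↭-refl))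

  data PromoteView (a : A) (ys : List A) : List A → Set where
    stay : PromoteView a ys (a ∷ ys)
    slid : ∀ {c zs} → c ≺ a → c ∈ ys → PromoteView a ys (c ∷ zs)

  -- Each handover passes to a smaller letter, so by transitivity the final carried letter is `a` or
  -- lies below `a`.
  promoteView : ∀ a ys → PromoteView a ys (promote a ys)
  promoteView a []       = stay
  promoteView a (y ∷ ys) with promote a ys | promoteView a ys
  ... | .a ∷ .ys | stay with y ≺? a
  ...   | yes y≺a = slid y≺a (here refl)
  ...   | no  _   = stay
  promoteView a (y ∷ ys) | c ∷ zs | slid c≺a c∈ with y ≺? c
  ...   | yes y≺c = slid (≺-trans y≺c c≺a) (here refl)
  ...   | no  _   = slid c≺a (there c∈)

  -- Behind `y` only the letter `a` is new, so a letter below `y` could only be `a`. After a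
  -- handover `c ≺ a`, so `a ≺ y` would give `c ≺ y`, although `c` stands behind `y` in a linear
  -- word.
  promote-linear : ∀ a {ys} → Linear ys → Linear (promote a ys)
  promote-linear a []                = [] ∷ []
  promote-linear a {y ∷ ys} (y⊀ ∷ l)
    with promote a ys | promote-linear a l | promote-↭ a ys | promoteView a ys
  ... | .a ∷ .ys | a⊀ ∷ _ | _ | stay with y ≺? a
  ...   | yes y≺a = ((≺-irrefl ∘ ≺-trans y≺a) ∷ y⊀) ∷ a⊀ ∷ l
  ...   | no  y⊀a = (y⊀a ∷ a⊀) ∷ y⊀ ∷ l
  promote-linear a {y ∷ ys} (y⊀ ∷ l) | c ∷ zs | c⊀ ∷ lz | c∷zs↭ | slid c≺a c∈ with y ≺? c
  ...   | yes y≺c = All.tabulate y-first ∷ c⊀ ∷ lz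
    where
    y-first : ∀ {z} → z ∈ c ∷ zs → ¬ z ≺ y
    y-first z∈ z≺y with ∈-resp-↭ c∷zs↭ z∈
    ... | here refl = ≺-irrefl (≺-trans (≺-trans z≺y y≺c) c≺a)
    ... | there z∈′ = All.lookup y⊀ z∈′ z≺y
  ...   | no  y⊀c = (y⊀c ∷ c⊀) ∷ All.tabulate y-first ∷ lz
    where
    y-first : ∀ {z} → z ∈ zs → ¬ z ≺ y
    y-first z∈ z≺y with ∈-resp-↭ c∷zs↭ (there z∈)
    ... | here refl = All.lookup y⊀ c∈ (≺-trans c≺a z≺y)
    ... | there z∈′ = All.lookup y⊀ z∈′ z≺y

  -- The carried letters lie below a, so (when P is an antichain) undoing promotion
  -- from the left, the first carried letter satisfying P is a itself.
  module _ {P : Pred A 0ℓ} (P? : Decidable P) where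

    demote : A → List A → A × List A
    demote c []       = c , []
    demote c (z ∷ zs) with P? c | c ≺? z
    ... | yes _ | _     = c , z ∷ zs
    ... | no  _ | yes _ = map₂ (c ∷_) (demote z zs)
    ... | no  _ | no  _ = map₂ (z ∷_) (demote c zs)

    demote-stop : ∀ {c} → P c → ∀ zs → demote c zs ≡ (c , zs)
    demote-stop     p []       = refl
    demote-stop {c} p (z ∷ zs) with P? c | c ≺? z
    ... | yes _ | _ = refl
    ... | no ¬p | _ = contradiction p ¬p

    -- Comparing the carried letter `c` with the next letter tells which branch `step` took. After a
    -- handover the two letters are in increasing order. If `c` passed `y` instead, `c ≺ y` is
    -- impossible, because `c` comes after `y` in the linear word `y ∷ ys`.
    demote-promote : ∀ {a} → P a → ∀ {ys} → Linear ys → (∀ {u} → u ∈ ys → u ≺ a → ¬ P u) →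
                     ∀ {c zs} → promote a ys ≡ c ∷ zs → demote c zs ≡ (a , ys)
    demote-promote     pa []                _  refl = refl
    demote-promote {a} pa {y ∷ ys} (y⊀ ∷ l) ¬P eq
      -- The induction hypothesis is abstracted together with `promote a ys`, so that `refl`
      -- discharges its equation in every case.
      with promote a ys | promoteView a ys | (λ {c} {zs} → demote-promote pa l (¬P ∘ there) {c} {zs})
    ... | .a ∷ .ys | stay | ih with y ≺? a | eq
    ...   | yes y≺a | refl with P? y | y ≺? a
    ...     | yes py | _       = contradiction py (¬P (here refl) y≺a)
    ...     | no  _  | yes _   = cong (map₂ (y ∷_)) (ih refl)
    ...     | no  _  | no y⊀a  = contradiction y≺a y⊀a
    demote-promote {a} pa {y ∷ ys} (y⊀ ∷ l) ¬P eq | .a ∷ .ys | stay | ih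
          | no  y⊀a | refl = demote-stop pa (y ∷ ys)
    demote-promote {a} pa {y ∷ ys} (y⊀ ∷ l) ¬P eq | c ∷ zs | slid c≺a c∈ | ih with y ≺? c | eq
    ...   | yes y≺c | refl with P? y | y ≺? c
    ...     | yes py | _       = contradiction py (¬P (here refl) (≺-trans y≺c c≺a))
    ...     | no  _  | yes _   = cong (map₂ (y ∷_)) (ih refl)
    ...     | no  _  | no y⊀c  = contradiction y≺c y⊀c
    demote-promote {a} pa {y ∷ ys} (y⊀ ∷ l) ¬P eq | c ∷ zs | slid c≺a c∈ | ih
          | no  y⊀c | refl with P? c | c ≺? y
    ...     | yes pc | _       = contradiction pc (¬P (there c∈) c≺a)
    ...     | no  _  | yes c≺y = contradiction c≺y (All.lookup y⊀ c∈)
    ...     | no  _  | no  _   = cong (map₂ (y ∷_)) (ih refl)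

  -- One predicate `P` serves both sides, so `demote` computes both pairs from the same word.
  promote-injective : ∀ {P : Pred A 0ℓ} → Decidable P → ∀ {a b ys zs} →
    P a → P b → Linear ys → Linear zs →
    (∀ {u} → u ∈ ys → u ≺ a → ¬ P u) → (∀ {u} → u ∈ zs → u ≺ b → ¬ P u) →
    promote a ys ≡ promote b zs → a ∷ ys ≡ b ∷ zs
  promote-injective P? {a} {b} {ys} {zs} pa pb ly lz ¬Py ¬Pz eq
    with promote a ys in eq₁ | promoteView a ys
  ... | c ∷ ws | _ with refl ← trans (sym (demote-promote P? pa ly ¬Py eq₁)) (demote-promote P? pb lz ¬Pz (sym eq)) = refl

  words : List A → List (List A)
  words xs = filter linear? (permutations xs)

  -- A word v ∷ w with w linear encodes a pair of v ∈ S and a linear extension of S - v.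
  tailLinear? : Decidable (Linear ∘ drop 1)
  tailLinear? = linear? ∘ drop 1

  -- The antichain inequalities of all colour classes in a single injection: `v ∷ w` is sent to the
  -- colour of `v` and the promoted word. The list is nonempty so that there is a first letter; for
  -- the empty list and `k = 0` the bound would read 1 ≤ 0.
  tailLinear-bound : ∀ {x xs k} → Unique (x ∷ xs) → (col : A → ℕ) →
    (∀ {u} → u ∈ x ∷ xs → col u ℕ.< k) →
    (∀ {u v} → u ∈ x ∷ xs → v ∈ x ∷ xs → u ≺ v → col u ≢ col v) →
    length (filter tailLinear? (permutations (x ∷ xs))) ℕ.≤ k ℕ.* length (words (x ∷ xs))
  tailLinear-bound {x} {xs} {k} u col col< proper = begin
    length (filter tailLinear? (permutations (x ∷ xs)))
      ≤⟨ length-≤-injection (Unique.filter⁺ tailLinear? (permutations-unique u)) code code-∈ code-injective ⟩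
    length (cartesianProduct (upTo k) (words (x ∷ xs)))
      ≡⟨ length-cartesianProduct (upTo k) _ ⟩
    length (upTo k) ℕ.* length (words (x ∷ xs))
      ≡⟨ cong (ℕ._* _) (length-upTo k) ⟩
    k ℕ.* length (words (x ∷ xs)) ∎
    where
    open ℕ.≤-Reasoning

    X : List (List A)
    X = filter tailLinear? (permutations (x ∷ xs))

    X-↭ : ∀ {σ} → σ ∈ X → σ ↭ x ∷ xs
    X-↭ = ∈-permutations⁻ (x ∷ xs) ∘ proj₁ ∘ ∈-filter⁻ tailLinear?

    X-linear : ∀ {σ} → σ ∈ X → Linear (drop 1 σ)
    X-linear = proj₂ ∘ ∈-filter⁻ tailLinear? {xs = permutations (x ∷ xs)}

    code : ∀ {σ} → σ ∈ X → ℕ × List A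
    -- A dummy value: every word in `X` is a permutation of a nonempty list.
    code {[]}    _ = 0 , []
    code {v ∷ w} _ = col v , promote v w

    code-∈ : ∀ {σ} (p : σ ∈ X) → code p ∈ cartesianProduct (upTo k) (words (x ∷ xs))
    code-∈ {[]}    p = contradiction (↭-sym (X-↭ p)) ¬x∷xs↭[]
    code-∈ {v ∷ w} p = ∈-cartesianProduct⁺
      (∈-upTo⁺ (col< (∈-resp-↭ (X-↭ p) (here refl))))
      (∈-filter⁺ linear?
        (∈-permutations⁺ (x ∷ xs) (↭-trans (promote-↭ v w) (X-↭ p)))
        (promote-linear v (X-linear p)))

    antichain : ∀ {v w} → v ∷ w ∈ X → ∀ {u} → u ∈ w → u ≺ v → col u ≢ col v
    antichain p u∈ = proper (∈-resp-↭ (X-↭ p) (there u∈)) (∈-resp-↭ (X-↭ p) (here refl))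

    code-injective : ∀ {σ τ} (p : σ ∈ X) (q : τ ∈ X) → code p ≡ code q → σ ≡ τ
    code-injective {[]}    {_}      p _ _  = contradiction (↭-sym (X-↭ p)) ¬x∷xs↭[]
    code-injective {_ ∷ _} {[]}     _ q _  = contradiction (↭-sym (X-↭ q)) ¬x∷xs↭[]
    -- `P` is the colour class of `v′`; it contains `v` because the codes agree in their first
    -- component.
    code-injective {v ∷ w} {v′ ∷ w′} p q eq = promote-injective (λ u → col u ℕ.≟ col v′)
      col≡ refl (X-linear p) (X-linear q)
      (λ u∈ u≺v → antichain p u∈ u≺v ∘ (λ e → trans e (sym col≡)))
      (antichain q) (cong proj₂ eq)
      where
      col≡ : col v ≡ col v′
      col≡ = cong proj₁ eq

-- Rational arithmetic, reduced to integers through unnormalised fractions.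

fromℚᵘ-homo-+ : ∀ p q → fromℚᵘ (p ℚᵘ.+ q) ≡ fromℚᵘ p ℚ.+ fromℚᵘ q
fromℚᵘ-homo-+ p q = ℚ.toℚᵘ-injective (begin-equality
  ℚ.toℚᵘ (fromℚᵘ (p ℚᵘ.+ q))                      ≃⟨ ℚ.toℚᵘ-fromℚᵘ (p ℚᵘ.+ q) ⟩
  p ℚᵘ.+ q                                        ≃⟨ ℚᵘ.+-cong (ℚ.toℚᵘ-fromℚᵘ p) (ℚ.toℚᵘ-fromℚᵘ q) ⟨
  ℚ.toℚᵘ (fromℚᵘ p) ℚᵘ.+ ℚ.toℚᵘ (fromℚᵘ q)        ≃⟨ ℚ.toℚᵘ-homo-+ (fromℚᵘ p) (fromℚᵘ q) ⟨
  ℚ.toℚᵘ (fromℚᵘ p ℚ.+ fromℚᵘ q)                  ∎)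
  where open ℚᵘ.≤-Reasoning

fromℚᵘ-homo-* : ∀ p q → fromℚᵘ (p ℚᵘ.* q) ≡ fromℚᵘ p ℚ.* fromℚᵘ q
fromℚᵘ-homo-* p q = ℚ.toℚᵘ-injective (begin-equality
  ℚ.toℚᵘ (fromℚᵘ (p ℚᵘ.* q))                      ≃⟨ ℚ.toℚᵘ-fromℚᵘ (p ℚᵘ.* q) ⟩
  p ℚᵘ.* q                                        ≃⟨ ℚᵘ.*-cong (ℚ.toℚᵘ-fromℚᵘ p) (ℚ.toℚᵘ-fromℚᵘ q) ⟨
  ℚ.toℚᵘ (fromℚᵘ p) ℚᵘ.* ℚ.toℚᵘ (fromℚᵘ q)        ≃⟨ ℚ.toℚᵘ-homo-* (fromℚᵘ p) (fromℚᵘ q) ⟨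
  ℚ.toℚᵘ (fromℚᵘ p ℚ.* fromℚᵘ q)                  ∎)
  where open ℚᵘ.≤-Reasoning

fromℚᵘ-mono-≤ : ∀ {p q} → p ℚᵘ.≤ q → fromℚᵘ p ≤ fromℚᵘ q
fromℚᵘ-mono-≤ {p} {q} p≤q = ℚ.toℚᵘ-cancel-≤ (begin
  ℚ.toℚᵘ (fromℚᵘ p)  ≃⟨ ℚ.toℚᵘ-fromℚᵘ p ⟩
  p                  ≤⟨ p≤q ⟩
  q                  ≃⟨ ℚ.toℚᵘ-fromℚᵘ q ⟨
  ℚ.toℚᵘ (fromℚᵘ q)  ∎)
  where open ℚᵘ.≤-Reasoning

fromℕ : ℕ → ℚ
fromℕ m = + m / 1

fromℕ-suc : ∀ m → fromℕ (suc m) ≡ 1ℚ ℚ.+ fromℕ m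
fromℕ-suc m = trans
  -- The unnormalised sum of 1/1 and m/1 has numerator `1 + m * 1`, so `m` is first replaced by
  -- `m * 1`.
  (cong (λ k → fromℚᵘ (mkℚᵘ (+ suc k) 0)) (sym (ℕ.*-identityʳ m)))
  (trans (cong (λ z → fromℚᵘ (mkℚᵘ (+ 1 ℤ.+ z) 0)) (ℤ.pos-* m 1)) (fromℚᵘ-homo-+ ℚᵘ.1ℚᵘ (mkℚᵘ (+ m) 0)))

fromℕ-mono-≤ : ∀ {m n} → m ℕ.≤ n → fromℕ m ≤ fromℕ n
fromℕ-mono-≤ {m} {n} m≤n = fromℚᵘ-mono-≤ {mkℚᵘ (+ m) 0} {mkℚᵘ (+ n) 0}
  (*≤* (ℤ.*-monoʳ-≤-nonNeg (+ 1) (ℤ.+≤+ m≤n)))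

-- The value 0 at 0 makes `recip` multiplicative on all of `ℕ`.
recip-* : ∀ m n → recip (m ℕ.* n) ≡ recip m ℚ.* recip n
recip-* zero    n       = sym (ℚ.*-zeroˡ (recip n))
recip-* (suc m) zero    rewrite ℕ.*-zeroʳ m = sym (ℚ.*-zeroʳ (recip (suc m)))
recip-* (suc m) (suc n) = fromℚᵘ-homo-* (mkℚᵘ (+ 1) m) (mkℚᵘ (+ 1) n)

recip-nonNegative : ∀ m → ℚ.NonNegative (recip m)
recip-nonNegative zero    = _
recip-nonNegative (suc m) = ℚ.normalize-nonNeg 1 (suc m)

recip-*-≤ : ∀ m {t e} → t ℕ.≤ m ℕ.* e → recip m ℚ.* fromℕ t ≤ fromℕ e
recip-*-≤ zero    {t} {e} _    rewrite ℚ.*-zeroˡ (fromℕ t) = fromℕ-mono-≤ {0} {e} ℕ.z≤n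
recip-*-≤ (suc m) {t} {e} t≤me rewrite sym (fromℚᵘ-homo-* (mkℚᵘ (+ 1) m) (mkℚᵘ (+ t) 0)) =
  fromℚᵘ-mono-≤ {mkℚᵘ (+ 1) m ℚᵘ.* mkℚᵘ (+ t) 0} {mkℚᵘ (+ e) 0} (*≤* (begin
    + 1 ℤ.* + t ℤ.* + 1       ≡⟨ ℤ.*-identityʳ (+ 1 ℤ.* + t) ⟩
    + 1 ℤ.* + t               ≡⟨ ℤ.*-identityˡ (+ t) ⟩
    + t                       ≤⟨ ℤ.+≤+ t≤me ⟩
    + (suc m ℕ.* e)           ≡⟨ cong +_ (ℕ.*-comm (suc m) e) ⟩
    -- `suc m * 1` is the denominator of the unnormalised product of 1/(m+1) and t/1.
    + (e ℕ.* suc m)           ≡⟨ cong (λ k → + (e ℕ.* k)) (ℕ.*-identityʳ (suc m)) ⟨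
    + (e ℕ.* (suc m ℕ.* 1))   ≡⟨ ℤ.pos-* e (suc m ℕ.* 1) ⟩
    + e ℤ.* + (suc m ℕ.* 1)   ∎))
  where open ℤ.≤-Reasoning

-- Finite sums of rationals.

module _ {A : Set} where

  -- Shaped like `chiSum`, so that the two agree by unfolding.
  ∑ : (A → ℚ) → List A → ℚ
  ∑ f xs = foldr ℚ._+_ 0ℚ (map f xs)

  ∑-cong : ∀ {f g : A → ℚ} → (∀ x → f x ≡ g x) → ∀ xs → ∑ f xs ≡ ∑ g xs
  ∑-cong eq xs = cong (foldr ℚ._+_ 0ℚ) (map-cong eq xs)

  ∑-mono : ∀ {f g : A → ℚ} xs → (∀ {x} → x ∈ xs → f x ≤ g x) → ∑ f xs ≤ ∑ g xs
  ∑-mono []       _ = ℚ.≤-refl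
  ∑-mono (x ∷ xs) h = ℚ.+-mono-≤ (h (here refl)) (∑-mono xs (h ∘ there))

  ∑-++ : ∀ (f : A → ℚ) xs ys → ∑ f (xs ++ ys) ≡ ∑ f xs ℚ.+ ∑ f ys
  ∑-++ f []       ys = sym (ℚ.+-identityˡ _)
  ∑-++ f (x ∷ xs) ys = trans (cong (f x ℚ.+_) (∑-++ f xs ys)) (sym (ℚ.+-assoc (f x) _ _))

  ∑-+ : ∀ (f g : A → ℚ) xs → ∑ (λ x → f x ℚ.+ g x) xs ≡ ∑ f xs ℚ.+ ∑ g xs
  ∑-+ f g []       = refl
  ∑-+ f g (x ∷ xs) = trans (cong (f x ℚ.+ g x ℚ.+_) (∑-+ f g xs))
    (+-interchange (f x) (g x) (∑ f xs) (∑ g xs))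
    where
    open import Algebra.Properties.CommutativeSemigroup (CommutativeMonoid.commutativeSemigroup ℚ.+-0-commutativeMonoid)
      renaming (interchange to +-interchange)

  ∑-*ˡ : ∀ c (f : A → ℚ) xs → ∑ (λ x → c ℚ.* f x) xs ≡ c ℚ.* ∑ f xs
  ∑-*ˡ c f []       = sym (ℚ.*-zeroʳ c)
  ∑-*ˡ c f (x ∷ xs) = trans (cong (c ℚ.* f x ℚ.+_) (∑-*ˡ c f xs)) (sym (ℚ.*-distribˡ-+ c (f x) _))

  ∑-map : ∀ {B : Set} (f : A → ℚ) (g : B → A) xs → ∑ f (map g xs) ≡ foldr ℚ._+_ 0ℚ (map (f ∘ g) xs)
  ∑-map f g xs = cong (foldr ℚ._+_ 0ℚ) (sym (map-∘ xs))

  indicator : ∀ {P : Pred A 0ℓ} → Decidable P → A → ℚ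
  indicator P? x = if does (P? x) then 1ℚ else 0ℚ

  -- Writes a count of words as a sum, so that `∑-permutations` can split and regroup counts too.
  ∑-indicator : ∀ {P : Pred A 0ℓ} (P? : Decidable P) xs → ∑ (indicator P?) xs ≡ fromℕ (length (filter P? xs))
  ∑-indicator P? []       = refl
  ∑-indicator P? (x ∷ xs) with does (P? x)
  ... | true  = trans (cong (1ℚ ℚ.+_) (∑-indicator P? xs)) (sym (fromℕ-suc (length (filter P? xs))))
  ... | false = trans (ℚ.+-identityˡ _) (∑-indicator P? xs)

∑-concatMap : ∀ {A B : Set} (f : B → ℚ) (g : A → List B) xs → ∑ f (concatMap g xs) ≡ ∑ (∑ f ∘ g) xs
∑-concatMap f g []       = refl
∑-concatMap f g (x ∷ xs) = trans (∑-++ f (g x) (concatMap g xs)) (cong (∑ f (g x) ℚ.+_) (∑-concatMap f g xs))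

-- Sums over permutations, split by first letter.

module _ {A : Set} where

  selections : List A → List (A × List A)
  selections []       = []
  selections (x ∷ xs) = (x , xs) ∷ map (map₂ (x ∷_)) (selections xs)

  -- Inserting `x` in front gives the words that begin with `x`. Every other insertion keeps the
  -- first letter of the word and puts `x` somewhere behind it; the sum of these is `later`, and the
  -- induction hypothesis for `later` sorts it by that letter.
  ∑-permutations : ∀ (f : List A → ℚ) x xs →
    ∑ f (permutations (x ∷ xs)) ≡ ∑ (λ (v , r) → ∑ (f ∘ (v ∷_)) (permutations r)) (selections (x ∷ xs))
  ∑-permutations f x []         = sym (ℚ.+-identityʳ _)
  ∑-permutations f x xs@(y ∷ ys) = begin
    ∑ f (concatMap (insertions x) (permutations xs))
      ≡⟨ ∑-concatMap f (insertions x) (permutations xs) ⟩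
    ∑ (∑ f ∘ insertions x) (permutations xs)
      ≡⟨ ∑-cong split (permutations xs) ⟩
    ∑ (λ σ → f (x ∷ σ) ℚ.+ later σ) (permutations xs)
      ≡⟨ ∑-+ (f ∘ (x ∷_)) later (permutations xs) ⟩
    ∑ (f ∘ (x ∷_)) (permutations xs) ℚ.+ ∑ later (permutations xs)
      ≡⟨ cong (∑ (f ∘ (x ∷_)) (permutations xs) ℚ.+_) laterSum ⟩
    ∑ branch (selections (x ∷ xs)) ∎
    where
    open ≡-Reasoning
    branch : A × List A → ℚ
    branch (v , r) = ∑ (f ∘ (v ∷_)) (permutations r)

    later : List A → ℚ
    -- The empty word admits only the insertion in front.
    later []      = 0ℚ
    later (z ∷ σ) = ∑ (f ∘ (z ∷_)) (insertions x σ)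

    split : ∀ σ → ∑ f (insertions x σ) ≡ f (x ∷ σ) ℚ.+ later σ
    split []      = refl
    split (z ∷ σ) = cong (f (x ∷ z ∷ σ) ℚ.+_) (∑-map f (z ∷_) (insertions x σ))

    laterSum : ∑ later (permutations xs) ≡ ∑ branch (map (map₂ (x ∷_)) (selections xs))
    laterSum = begin
      ∑ later (permutations xs)
        ≡⟨ ∑-permutations later y ys ⟩
      ∑ (λ (v , r) → ∑ (∑ (f ∘ (v ∷_)) ∘ insertions x) (permutations r)) (selections xs)
        ≡⟨ ∑-cong (λ (v , r) → ∑-concatMap (f ∘ (v ∷_)) (insertions x) (permutations r)) (selections xs) ⟨
      ∑ (branch ∘ map₂ (x ∷_)) (selections xs)
        ≡⟨ ∑-map branch (map₂ (x ∷_)) (selections xs) ⟨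
      ∑ branch (map (map₂ (x ∷_)) (selections xs)) ∎

Unique-resp-↭ : ∀ {A : Set} {xs ys : List A} → xs ↭ ys → Unique xs → Unique ys
Unique-resp-↭ {A} p = ↭ₛ.Unique-resp-↭ (setoid A) (↭⇒↭ₛ p)

selections-↭ : ∀ {A : Set} (xs : List A) {v r} → (v , r) ∈ selections xs → v ∷ r ↭ xs
selections-↭ (x ∷ xs) (here refl) = ↭-refl
selections-↭ (x ∷ xs) (there p) with ∈-map⁻ (map₂ (x ∷_)) p
... | (v , r) , q , refl = ↭-trans (swap v x ↭-refl) (prep x (selections-↭ xs q))

-- Enumeration of all value tables.

vectors : ∀ {A : Set} → List A → ∀ m → List (Vec A m)
vectors xs zero    = [] ∷ []
vectors xs (suc m) = cartesianProductWith _∷_ xs (vectors xs m)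

vectors-unique : ∀ {A : Set} {xs : List A} → Unique xs → ∀ m → Unique (vectors xs m)
vectors-unique u zero    = All.[] ∷ []
vectors-unique u (suc m) = Unique.cartesianProductWith⁺ _∷_ Vec.∷-injective u (vectors-unique u m)

∈-vectors : ∀ {n m} (w : Vec (Fin n) m) → w ∈ vectors (allFin n) m
∈-vectors []      = here refl
∈-vectors (x ∷ w) = ∈-cartesianProductWith⁺ _∷_ (∈-allFin x) (∈-vectors w)

-- A decidable strict order: the chromatic bound on linear words.

module StrictOrder {n} (_≺_ : Fin n → Fin n → Set) (_≺?_ : ∀ x y → Dec (x ≺ y))
  (≺-irrefl : ∀ {x} → ¬ x ≺ x) (≺-trans : ∀ {x y z} → x ≺ y → y ≺ z → x ≺ z) where

  open Promotion _≺_ _≺?_ ≺-irrefl ≺-trans public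

  module _ (G : SimpleGraph n) (≺⇒adj : ∀ {u v} → u ≺ v → adj G u v ≡ true)
    (chi : Subset n → ℕ) (chromatic : ∀ S → IsChromaticNumber G S (chi S)) where

    -- Comparable vertices are adjacent, so an optimal proper colouring of `S` gives them different
    -- colours.
    tailLinear-chi-bound : ∀ {x xs} S → Unique (x ∷ xs) → (∀ {u} → u ∈ x ∷ xs → u Subset.∈ S) →
      length (filter tailLinear? (permutations (x ∷ xs))) ℕ.≤ chi S ℕ.* length (words (x ∷ xs))
    tailLinear-chi-bound {x} {xs} S u ⊆S = tailLinear-bound u colour colour< proper
      where
      c = proj₁ (proj₁ (chromatic S))

      colour : Fin n → ℕ
      colour v with v Subset.∈? S
      ... | yes v∈ = Fin.toℕ (c v v∈)
      -- Never reached on the letters of the word, which all lie in `S`.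
      ... | no  _  = 0

      colour< : ∀ {v} → v ∈ x ∷ xs → colour v ℕ.< chi S
      colour< {v} v∈ with v Subset.∈? S
      ... | yes v∈S = Fin.toℕ<n (c v v∈S)
      ... | no  v∉S = contradiction (⊆S v∈) v∉S

      proper : ∀ {v w} → v ∈ x ∷ xs → w ∈ x ∷ xs → v ≺ w → colour v ≢ colour w
      proper {v} {w} v∈ w∈ v≺w with v Subset.∈? S | w Subset.∈? S
      ... | yes v∈S | yes w∈S = proj₂ (proj₁ (chromatic S)) v w v∈S w∈S (≺⇒adj v≺w) ∘ Fin.toℕ-injective
      ... | yes _   | no  w∉S = contradiction (⊆S w∈) w∉S
      ... | no  v∉S | _       = contradiction (⊆S v∈) v∉S

    -- This is f(S) ≤ e(S). The induction runs on the length `m`, since the remainder of a selection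
    -- is not a subterm of `xs`.
    ∑-recip≤words : ∀ m xs S → length xs ≡ m → Unique xs → (∀ {u} → u ∈ xs → u Subset.∈ S) →
      ∑ (recip ∘ chiProduct chi S) (permutations xs) ≤ fromℕ (length (words xs))
    -- Both sides evaluate to 1: the empty product and the empty word.
    ∑-recip≤words zero    []          S _   _ _  = ℚ.≤-refl
    ∑-recip≤words (suc m) xs@(x ∷ xs′) S len u ⊆S = begin
      ∑ (recip ∘ chiProduct chi S) (permutations xs)
        ≡⟨ ∑-permutations (recip ∘ chiProduct chi S) x xs′ ⟩
      ∑ (λ (v , r) → ∑ (λ σ → recip (chi S ℕ.* chiProduct chi (S Subset.- v) σ)) (permutations r)) (selections xs)
        ≤⟨ ∑-mono (selections xs) branch≤ ⟩
      ∑ (λ (v , r) → ∑ (λ σ → recip (chi S) ℚ.* indicator linear? σ) (permutations r)) (selections xs)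
        -- The splitting is now read backwards: a vertex `v` with a linear word on the rest is a
        -- word whose tail is linear.
        ≡⟨ ∑-permutations (λ σ → recip (chi S) ℚ.* indicator linear? (drop 1 σ)) x xs′ ⟨
      ∑ (λ σ → recip (chi S) ℚ.* indicator linear? (drop 1 σ)) (permutations xs)
        ≡⟨ ∑-*ˡ (recip (chi S)) (indicator linear? ∘ drop 1) (permutations xs) ⟩
      recip (chi S) ℚ.* ∑ (indicator linear? ∘ drop 1) (permutations xs)
        ≡⟨ cong (recip (chi S) ℚ.*_) (∑-indicator tailLinear? (permutations xs)) ⟩
      recip (chi S) ℚ.* fromℕ (length (filter tailLinear? (permutations xs)))
        ≤⟨ recip-*-≤ (chi S) (tailLinear-chi-bound S u ⊆S) ⟩
      fromℕ (length (words xs)) ∎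
      where
      open ℚ.≤-Reasoning

      branch≤ : ∀ {(v , r) : Fin n × List (Fin n)} → (v , r) ∈ selections xs →
        ∑ (λ σ → recip (chi S ℕ.* chiProduct chi (S Subset.- v) σ)) (permutations r) ≤
        ∑ (λ σ → recip (chi S) ℚ.* indicator linear? σ) (permutations r)
      branch≤ {v , r} vr∈ with selections-↭ xs vr∈
      ... | p with Unique-resp-↭ (↭-sym p) u
      ... | v≢ ∷ ur = begin
        ∑ (λ σ → recip (chi S ℕ.* chiProduct chi (S Subset.- v) σ)) (permutations r)
          ≡⟨ ∑-cong (λ σ → recip-* (chi S) (chiProduct chi (S Subset.- v) σ)) (permutations r) ⟩
        ∑ (λ σ → recip (chi S) ℚ.* recip (chiProduct chi (S Subset.- v) σ)) (permutations r)
          ≡⟨ ∑-*ˡ (recip (chi S)) (recip ∘ chiProduct chi (S Subset.- v)) (permutations r) ⟩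
        recip (chi S) ℚ.* ∑ (recip ∘ chiProduct chi (S Subset.- v)) (permutations r)
          ≤⟨ ℚ.*-monoˡ-≤-nonNeg (recip (chi S)) {{recip-nonNegative (chi S)}}
               (∑-recip≤words m r (S Subset.- v) (ℕ.suc-injective (trans (↭-length p) len)) ur
                 (λ u∈ → Subset.x∈p∧x≢y⇒x∈p-y (⊆S (∈-resp-↭ p (there u∈))) (All.lookup v≢ u∈ ∘ sym))) ⟩
        recip (chi S) ℚ.* fromℕ (length (words r))
          ≡⟨ cong (recip (chi S) ℚ.*_) (∑-indicator linear? (permutations r)) ⟨
        recip (chi S) ℚ.* ∑ (indicator linear?) (permutations r)
          ≡⟨ ∑-*ˡ (recip (chi S)) (indicator linear?) (permutations r) ⟨
        ∑ (λ σ → recip (chi S) ℚ.* indicator linear? σ) (permutations r) ∎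

  -- Linear words and linear extensions given by value tables.

  Monotone : Vec (Fin n) n → Set
  Monotone w = ∀ a b → a ≺ b → Vec.lookup w a Fin.< Vec.lookup w b

  -- Spelled out with quantifiers over `Fin n` so that finite search decides it.
  Bijection : Vec (Fin n) n → Set
  Bijection w = (∀ x y → Vec.lookup w x ≡ Vec.lookup w y → x ≡ y) × (∀ y → ∃ λ x → Vec.lookup w x ≡ y)

  extension? : ∀ w → Dec (Bijection w × Monotone w)
  extension? w =
    (Fin.all? (λ x → Fin.all? (λ y → (Vec.lookup w x Fin.≟ Vec.lookup w y) →-dec (x Fin.≟ y)))
      ×-dec Fin.all? (λ y → Fin.any? (λ x → Vec.lookup w x Fin.≟ y)))
    ×-dec Fin.all? (λ a → Fin.all? (λ b → (a ≺? b) →-dec (Vec.lookup w a Fin.<? Vec.lookup w b)))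

  extensions : List (Vec (Fin n) n)
  extensions = filter extension? (vectors (allFin n) n)

  module _ {σ} (σ↭ : σ ↭ allFin n) where

    σ-unique : Unique σ
    σ-unique = Unique-resp-↭ (↭-sym σ↭) (Unique.allFin⁺ n)

    σ-length : length σ ≡ n
    σ-length = trans (↭-length σ↭) (length-tabulate (λ i → i))

    σ-full : ∀ u → u ∈ σ
    σ-full u = ∈-resp-↭ (↭-sym σ↭) (∈-allFin u)

    position : Fin n → Fin (length σ)
    position u = index (σ-full u)

    position-lookup : ∀ i → position (lookup σ i) ≡ i
    position-lookup i = lookup-Unique-injective σ-unique (sym (lookup-index (σ-full (lookup σ i))))

    -- The word lists the vertices by increasing value, so the linear extension sends a vertex to
    -- its place in the word.
    positions : Vec (Fin n) n
    positions = Vec.tabulate (Fin.cast σ-length ∘ position)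

    toℕ-positions : ∀ u → Fin.toℕ (Vec.lookup positions u) ≡ Fin.toℕ (position u)
    toℕ-positions u = trans (cong Fin.toℕ (Vec.lookup∘tabulate _ u)) (Fin.toℕ-cast σ-length (position u))

    positions-bijection : Bijection positions
    positions-bijection = inj , surj
      where
      inj : ∀ x y → Vec.lookup positions x ≡ Vec.lookup positions y → x ≡ y
      inj x y eq = index-injective (setoid (Fin n)) (σ-full x) (σ-full y)
        (Fin.toℕ-injective (trans (sym (toℕ-positions x)) (trans (cong Fin.toℕ eq) (toℕ-positions y))))
      surj : ∀ y → ∃ λ x → Vec.lookup positions x ≡ y
      surj y = lookup σ i , Fin.toℕ-injective
        (trans (toℕ-positions _) (trans (cong Fin.toℕ (position-lookup i)) (Fin.toℕ-cast (sym σ-length) y)))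
        where i = Fin.cast (sym σ-length) y

    positions-monotone : Linear σ → Monotone positions
    positions-monotone l a b a≺b with Fin.<-cmp (position a) (position b)
    ... | tri< a<b _ _ rewrite toℕ-positions a | toℕ-positions b = a<b
    ... | tri≈ _ a≈b _ = contradiction
      (subst (a ≺_) (sym (index-injective (setoid (Fin n)) (σ-full a) (σ-full b) a≈b)) a≺b) ≺-irrefl
    ... | tri> _ _ b<a with lookup-AllPairs l b<a
    ...   | ¬a≺b rewrite sym (lookup-index (σ-full a)) | sym (lookup-index (σ-full b)) = contradiction a≺b ¬a≺b

  -- The letter at place `i` of `σ` has the same position in `τ`, hence is the letter of `τ` at that
  -- place.
  positions-injective : ∀ {σ τ} (p : σ ↭ allFin n) (q : τ ↭ allFin n) → positions p ≡ positions q → σ ≡ τ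
  positions-injective {σ} {τ} p q eq = Pointwise-≡⇒≡ (lookup⁻ (trans (σ-length p) (sym (σ-length q))) same)
    where
    same : ∀ {i j} → Fin.toℕ i ≡ Fin.toℕ j → lookup σ i ≡ lookup τ j
    same {i} {j} i≡j = trans (lookup-index (σ-full q u)) (cong (lookup τ) (Fin.toℕ-injective (begin
      Fin.toℕ (position q u)                 ≡⟨ toℕ-positions q u ⟨
      Fin.toℕ (Vec.lookup (positions q) u)   ≡⟨ cong (λ w → Fin.toℕ (Vec.lookup w u)) eq ⟨
      Fin.toℕ (Vec.lookup (positions p) u)   ≡⟨ toℕ-positions p u ⟩
      Fin.toℕ (position p u)                 ≡⟨ cong Fin.toℕ (position-lookup p i) ⟩
      Fin.toℕ i                              ≡⟨ i≡j ⟩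
      Fin.toℕ j                              ∎)))
      where
      open ≡-Reasoning
      u = lookup σ i

  words≤extensions : length (words (allFin n)) ℕ.≤ length extensions
  words≤extensions = length-≤-injection
    (Unique.filter⁺ linear? (permutations-unique (Unique.allFin⁺ n)))
    (λ p → positions (word-↭ p))
    (λ p → ∈-filter⁺ extension? (∈-vectors _)
      (positions-bijection (word-↭ p) ,
       positions-monotone (word-↭ p) (proj₂ (∈-filter⁻ linear? {xs = permutations (allFin n)} p))))
    (λ p q → positions-injective (word-↭ p) (word-↭ q))
    where
    word-↭ : ∀ {σ} → σ ∈ words (allFin n) → σ ↭ allFin n
    word-↭ = ∈-permutations⁻ (allFin n) ∘ proj₁ ∘ ∈-filter⁻ linear?

  -- The orientation along the order and its linear extensions.

  orientation : Fin n → Fin n → Bool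
  orientation u v = does (u ≺? v)

  orientation⇒≺ : ∀ {u v} → orientation u v ≡ true → u ≺ v
  orientation⇒≺ {u} {v} eq with yes u≺v ← u ≺? v = u≺v

  ≺⇒orientation : ∀ {u v} → u ≺ v → orientation u v ≡ true
  ≺⇒orientation {u} {v} = dec-true (u ≺? v)

  -- Transitivity collapses a path to one comparison, so the order induced by the orientation is `≺`
  -- itself and acyclicity is irreflexivity.
  path⇒≺ : ∀ {u v} → Path orientation u v → u ≺ v
  path⇒≺ [ e ]    = orientation⇒≺ e
  path⇒≺ (e ∷ es) = ≺-trans (orientation⇒≺ e) (path⇒≺ es)

  extensions-count : NumLinearExtensions orientation (length extensions)
  extensions-count = extensions , refl
    , Unique.filter⁺ extension? (vectors-unique (Unique.allFin⁺ n) n)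
    , λ w → mk⇔ (to w ∘ proj₂ ∘ ∈-filter⁻ extension? {xs = vectors (allFin n) n})
                (∈-filter⁺ extension? (∈-vectors w) ∘ from w)
    where
    to : ∀ w → Bijection w × Monotone w → IsLinearExtension orientation w
    to w ((inj , surj) , mono) =
      ((λ {x} {y} → inj x y) , λ y → proj₁ (surj y) , λ { refl → proj₂ (surj y) }) ,
      λ a b → mono a b ∘ path⇒≺
    from : ∀ w → IsLinearExtension orientation w → Bijection w × Monotone w
    from w ((inj , surj) , mono) =
      ((λ x y → inj) , λ y → proj₁ (surj y) , proj₂ (surj y) refl) ,
      λ a b a≺b → mono a b [ ≺⇒orientation a≺b ]

-- The strict order of a comparability graph, and the inequality.

theorem4p3 : ∀ (n : ℕ) (G : SimpleGraph n) → IsComparabilityGraph G →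
    (chi : Subset n → ℕ) → (∀ S → IsChromaticNumber G S (chi S)) →
    (e : ℕ) → IsEpsilon G e →
    chiSum n chi ≤ (+ e / 1)
theorem4p3 n G (_≼_ , isPartialOrder , comparable) chi chromatic e (_ , maximal) = begin
  chiSum n chi
    ≤⟨ ∑-recip≤words G (λ {u} {v} → ≺⇒adj {u} {v}) chi chromatic n (allFin n) Subset.⊤
         (length-tabulate (λ i → i)) (Unique.allFin⁺ n) (λ _ → Subset.∈⊤) ⟩
  fromℕ (length (words (allFin n)))
    ≤⟨ fromℕ-mono-≤ words≤extensions ⟩
  fromℕ (length extensions)
    ≤⟨ fromℕ-mono-≤ (maximal orientation (length extensions) acyclic extensions-count) ⟩
  fromℕ e ∎
  where
  open IsPartialOrder isPartialOrder using (antisym) renaming (trans to ≼-trans)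

  _≺_ : Fin n → Fin n → Set
  u ≺ v = u ≼ v × u ≢ v

  ≺⇒adj : ∀ {u v} → u ≺ v → adj G u v ≡ true
  ≺⇒adj (u≼v , u≢v) = Equivalence.from (comparable _ _ u≢v) (inj₁ u≼v)

  ≺-trans : ∀ {x y z} → x ≺ y → y ≺ z → x ≺ z
  ≺-trans (x≼y , x≢y) (y≼z , _) = ≼-trans x≼y y≼z , λ { refl → x≢y (antisym x≼y y≼z) }

  -- The partial order comes with no decision procedure, but adjacency is Boolean, and for an edge
  -- `comparable` yields the direction that holds; antisymmetry excludes the other.
  _≺?_ : ∀ u v → Dec (u ≺ v)
  u ≺? v with u Fin.≟ v | adj G u v Bool.≟ true
  ... | yes u≡v | _       = no λ (_ , u≢v) → u≢v u≡v
  ... | no  _   | no  ¬uv = no (¬uv ∘ ≺⇒adj)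
  ... | no  u≢v | yes uv with Equivalence.to (comparable u v u≢v) uv
  ...   | inj₁ u≼v = yes (u≼v , u≢v)
  ...   | inj₂ v≼u = no λ (u≼v , _) → u≢v (antisym u≼v v≼u)

  open StrictOrder _≺_ _≺?_ (λ (_ , x≢x) → x≢x refl) ≺-trans
  open ℚ.≤-Reasoning

  acyclic : IsAcyclicOrientation G orientation
  acyclic = (oriented , λ u v → ≺⇒adj ∘ orientation⇒≺) , λ u p → proj₂ (path⇒≺ p) refl
    where
    oriented : ∀ u v → adj G u v ≡ true → _
    oriented u v uv with u Fin.≟ v
    ... | yes refl = case trans (sym uv) (irrfl G u) of λ ()
    ... | no  u≢v with Equivalence.to (comparable u v u≢v) uv
    ...   | inj₁ u≼v = inj₁ (≺⇒orientation (u≼v , u≢v) ,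
                             dec-false (v ≺? u) (λ (v≼u , _) → u≢v (antisym u≼v v≼u)))
    ...   | inj₂ v≼u = inj₂ (dec-false (u ≺? v) (λ (u≼v , _) → u≢v (antisym u≼v v≼u)) ,
                             ≺⇒orientation (v≼u , u≢v ∘ sym))
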